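{- Let $s\in\mathcal S(n+1)$ for some $n\in\omega$, let $M_0,\dots,M_{\ell(s)-1}$ be uniform chains of rank $\omega$, and suppose the chain $A=\mathcal A(s)[M_0,\dots,M_{\ell(s)-1}]$ is uniform. Then (a) $\mathrm f M_i\cong\mathrm f M_j$ for all $i,j<\ell(s)$, and (b) $M_i\cong M_j$ whenever $i,j<\ell(s)$ and $\mathrm{wt}^s(i)=\mathrm{wt}^s(j)$.
   Context: A chain is a linearly ordered set; $\cong$ is order isomorphism. $A+B$ and $\sum_{i\in I}A_i$ are ordered sums, $AB=\sum_{b\in B}A$ is the anti-lexicographically ordered product; $\mathbb N,\mathbb Z$ have their usual orders and $1$ is the one-element chain. For a chain $A$ define convex equivalence relations $\rho_\alpha$ ($\alpha$ an ordinal): $\rho_0$ is equality; $A/\alpha$ is the quotient chain of $\rho_\alpha$-classes and $[x]_\alpha$ is the class of $x$; $x\rho_{\alpha+1}y$ iff the interval between $[x]_\alpha$ and $[y]_\alpha$ in $A/\alpha$ is finite; for limit $\alpha$, $x\rho_\alpha y$ iff $x\rho_\beta y$ for some $\beta<\alpha$. The rank $\mathrm{rk}(A)$ is the least $\alpha$ with $A/\alpha\cong 1$. All chains are assumed decomposable (their rank is defined). $A$ is uniform if $A^{\ge x}=\{y\in A:x\le y\}$ has the same order type for all $x\in A$; then $\mathrm f A$ denotes this common tail. $\mathcal S(m)$ is the set of sequences $s=(s(0),\dots,s(m-1))$ of natural numbers with $s(i)\le i$ for all $i<m$; $|s|=m$. For $s$ of length $n+1\ge2$: $s^-$ is $s$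 with its last entry deleted, and $s^+$ is $s$ with its next-to-last entry $s(n-1)$ deleted; $s^+\in\mathcal S(n)$ iff $s(n)<n$. The tree of $s$ (nonempty) has root $(s;0)$; a node $(t;k)$ with $|t|=m+1\ge 2$ has the single child $(t^-;0)$ if $t(m)=m$, and a left child $(t^+;k+1)$ and a right child $(t^-;0)$ if $t(m)<m$. The leaves are the nodes $(\langle 0\rangle;k)$ on level $|s|-1$, ordered from left to right; $\ell(s)$ is their number and $\mathrm{wt}^s(i)=k$ if the $i$th leaf ($0\le i<\ell(s)$) is $(\langle0\rangle;k)$. For uniform chains $M_i$ of rank $\omega$: $\mathcal A(\langle0\rangle)[M_0]=M_0$, and for $s$ of length $n+1\ge 2$, $\mathcal A(s)[M_0,\dots,M_{\ell(s)-1}]=\mathcal A(s^-)[M_0,\dots,M_{\ell(s^-)-1}]\,\mathbb Z$ if $s(n)=n$ (then $\ell(s)=\ell(s^-)$), and $=\mathcal A(s^+)[M_0,\dots,M_{\ell(s^+)-1}]+\mathcal A(s^-)[M_{\ell(s^+)},\dots,M_{\ell(s)-1}]\,\mathbb N$ if $s(n)<n$ (then $\ell(s)=\ell(s^+)+\ell(s^-)$). -}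

module Defs where

open import Level using (Level; 0ℓ) renaming (suc to lsuc)
open import Data.Nat using (ℕ; zero; suc; _+_; _≟_)
import Data.Nat.Properties as ℕ
import Data.Integer.Properties as ℤ
import Data.Unit.Properties as ⊤
open import Data.Fin using (Fin; zero; toℕ; lower₁; _↑ˡ_; _↑ʳ_)
open import Data.List using (List; []; _∷_; _++_; map)
open import Data.List.Relation.Unary.Any using (here; there)
open import Data.List.Relation.Unary.Enumerates.Setoid using (IsEnumeration)
import Data.List.Membership.Setoid as Membership
open import Data.List.Membership.Setoid.Properties using (∈-++⁺ˡ; ∈-++⁺ʳ; ∈-map⁺)
open import Data.Product using (∃; ∃-syntax; _×_; _,_; proj₁; proj₂)
open import Data.Product.Relation.Binary.Lex.NonStrict using (×-totalOrder)
open import Data.Sum using (_⊎_; inj₁; inj₂)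
open import Data.Sum.Relation.Binary.LeftOrder using (⊎-<-totalOrder)
open import Data.Vec using (Vec; []; _∷_; lookup) renaming (_++_ to _++ᵛ_)
open import Relation.Binary using (Rel; IsEquivalence; Setoid; TotalOrder; DecTotalOrder)
import Relation.Binary.Construct.On as On
open import Relation.Binary.Construct.Add.Supremum.Strict Data.Nat._<_ using (_<⁺_)
open import Relation.Binary.Morphism.Structures using (IsOrderIsomorphism)
open import Relation.Binary.PropositionalEquality using (_≢_; subst)
open import Relation.Nullary using (¬_; yes; no)
open import Relation.Nullary.Construct.Add.Supremum using (_⁺; [_]; ⊤⁺)

private
  variable
    a b : Level

-- The equality of a chain is a setoid equality, so that a quotient chain A/α
-- has the carrier of A and ρ_α as its equality.

Chain : (a : Level) → Set (lsuc a)
Chain a = TotalOrder a a a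

∣_∣ : Chain a → Set a
∣ A ∣ = TotalOrder.Carrier A

infix 4 _≅_

_≅_ : Chain a → Chain b → Set _
A ≅ B = ∃[ h ] IsOrderIsomorphism A._≈_ B._≈_ A._≤_ B._≤_ h
  where
  module A = TotalOrder A
  module B = TotalOrder B

infixl 6 _⊕_
infixl 7 _⊗_

_⊕_ : Chain a → Chain a → Chain a
A ⊕ B = ⊎-<-totalOrder A B

-- The product AB is the sum of B copies of A, so the B-coordinate is compared
-- first and is put first here. Its equality must be decidable for the
-- lexicographic order to be total constructively.

_⊗_ : Chain a → DecTotalOrder 0ℓ 0ℓ 0ℓ → Chain a
A ⊗ B = ×-totalOrder B A

ℕ-chain ℤ-chain : DecTotalOrder 0ℓ 0ℓ 0ℓ
ℕ-chain = ℕ.≤-decTotalOrder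
ℤ-chain = ℤ.≤-decTotalOrder

𝟙 : Chain 0ℓ
𝟙 = DecTotalOrder.totalOrder ⊤.≡-decTotalOrder

_^≥_ : (A : Chain a) → ∣ A ∣ → Chain a
A ^≥ x = On.totalOrder A (proj₁ {B = x ≤_})
  where open TotalOrder A using (_≤_)

-- A uniform chain is nonempty, as is every chain that has a rank; the point
-- serves to name a representative of the common order type of the tails.

record Uniform (A : Chain a) : Set a where
  field
    point : ∣ A ∣
    tails : ∀ x y → A ^≥ x ≅ A ^≥ y

f : {A : Chain a} → Uniform A → Chain a
f {A = A} u = A ^≥ Uniform.point u


record ConvexEquivalence (A : Chain a) : Set (lsuc a) where
  open TotalOrder A using (_≈_; _≤_)
  field
    _~_           : Rel ∣ A ∣ a
    isEquivalence : IsEquivalence _~_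
    ≈⇒~           : ∀ {x y} → x ≈ y → x ~ y
    convex        : ∀ {x y z} → x ≤ y → y ≤ z → x ~ z → x ~ y

quotient : (A : Chain a) → ConvexEquivalence A → Chain a
quotient A E = record
  { Carrier      = ∣ A ∣
  ; _≈_          = _~_
  ; _≤_          = λ x y → x ≤ y ⊎ x ~ y
  ; isTotalOrder = record
    { isPartialOrder = record
      { isPreorder = record
        { isEquivalence = isEquivalence
        ; reflexive     = inj₂
        ; trans         = ≲-trans
        }
      ; antisym = ≲-antisym
      }
    ; total = ≲-total
    }
  }
  where
  open TotalOrder A using (_≤_; trans; antisym; total)
  open ConvexEquivalence E
  module ~ = IsEquivalence isEquivalence

  ≲-trans : ∀ {x y z} → x ≤ y ⊎ x ~ y → y ≤ z ⊎ y ~ z → x ≤ z ⊎ x ~ z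
  ≲-trans (inj₁ p) (inj₁ q) = inj₁ (trans p q)
  ≲-trans {x} {y} {z} (inj₁ p) (inj₂ q) with total x z
  ... | inj₁ r = inj₁ r
  ... | inj₂ r = inj₂ (~.sym (convex r p (~.sym q)))
  ≲-trans {x} {y} {z} (inj₂ p) (inj₁ q) with total x z
  ... | inj₁ r = inj₁ r
  ... | inj₂ r = inj₂ (~.trans p (convex q r (~.sym p)))
  ≲-trans (inj₂ p) (inj₂ q) = inj₂ (~.trans p q)

  ≲-antisym : ∀ {x y} → x ≤ y ⊎ x ~ y → y ≤ x ⊎ y ~ x → x ~ y
  ≲-antisym (inj₁ p) (inj₁ q) = ≈⇒~ (antisym p q)
  ≲-antisym (inj₁ p) (inj₂ q) = ~.sym q
  ≲-antisym (inj₂ p) _        = p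

  ≲-total : ∀ x y → (x ≤ y ⊎ x ~ y) ⊎ (y ≤ x ⊎ y ~ x)
  ≲-total x y with total x y
  ... | inj₁ p = inj₁ (inj₁ p)
  ... | inj₂ p = inj₂ (inj₁ p)

module _ (A : Chain a) where
  open TotalOrder A

  Between : ∣ A ∣ → ∣ A ∣ → ∣ A ∣ → Set a
  Between x y z = (x ≤ z × z ≤ y) ⊎ (y ≤ z × z ≤ x)

  interval : ∣ A ∣ → ∣ A ∣ → Setoid a a
  interval x y = On.setoid Eq.setoid (proj₁ {B = Between x y})

  -- Finite: listed in full, up to _≈_ and possibly with repetitions.

  FiniteInterval : Rel ∣ A ∣ a
  FiniteInterval x y = ∃[ zs ] IsEnumeration (interval x y) zs

module FiniteIntervalProperties (A : Chain a) where
  open TotalOrder A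

  private
    open Membership Eq.setoid using (_∈_)

    clamp : ∀ x y → ∣ A ∣ → ∃ (Between A x y)
    clamp x y z with total x y
    clamp x y z | inj₁ x≤y with total x z | total z y
    ... | inj₂ _   | _        = x , inj₁ (refl , x≤y)
    ... | inj₁ x≤z | inj₁ z≤y = z , inj₁ (x≤z , z≤y)
    ... | inj₁ _   | inj₂ _   = y , inj₁ (x≤y , refl)
    clamp x y z | inj₂ y≤x with total y z | total z x
    ... | inj₂ _   | _        = y , inj₂ (refl , y≤x)
    ... | inj₁ y≤z | inj₁ z≤x = z , inj₂ (y≤z , z≤x)
    ... | inj₁ _   | inj₂ _   = x , inj₂ (y≤x , refl)

    order : ∀ {x y z} → x ≤ y → Between A x y z → x ≤ z × z ≤ y
    order x≤y (inj₁ p)       = p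
    order x≤y (inj₂ (p , q)) = trans x≤y p , trans q x≤y

    order′ : ∀ {x y z} → y ≤ x → Between A x y z → y ≤ z × z ≤ x
    order′ y≤x (inj₁ (p , q)) = trans y≤x p , trans q y≤x
    order′ y≤x (inj₂ p)       = p

    clamp-fixes : ∀ x y z w → Between A x y z → z ≈ w → z ≈ proj₁ (clamp x y w)
    clamp-fixes x y z w p e with total x y
    clamp-fixes x y z w p e | inj₁ x≤y with total x w | total w y
    ... | inj₂ w≤x | _      =
      antisym (trans (reflexive e) w≤x) (proj₁ (order x≤y p))
    ... | inj₁ _   | inj₁ _ = e
    ... | inj₁ _   | inj₂ y≤w =
      antisym (proj₂ (order x≤y p)) (trans y≤w (reflexive (Eq.sym e)))
    clamp-fixes x y z w p e | inj₂ y≤x with total y w | total w x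
    ... | inj₂ w≤y | _      =
      antisym (trans (reflexive e) w≤y) (proj₁ (order′ y≤x p))
    ... | inj₁ _   | inj₁ _ = e
    ... | inj₁ _   | inj₂ x≤w =
      antisym (proj₂ (order′ y≤x p)) (trans x≤w (reflexive (Eq.sym e)))

    clamp-∈ : ∀ x y z (p : Between A x y z) (ws : List ∣ A ∣) → z ∈ ws →
              Membership._∈_ (interval A x y) (z , p) (map (clamp x y) ws)
    clamp-∈ x y z p (w ∷ _)  (here e)  = here (clamp-fixes x y z w p e)
    clamp-∈ x y z p (_ ∷ ws) (there i) = there (clamp-∈ x y z p ws i)

  Covers : ∣ A ∣ → ∣ A ∣ → List ∣ A ∣ → Set a
  Covers x y ws = ∀ z → Between A x y z → z ∈ ws

  covers⇒finite : ∀ {x y} ws → Covers x y ws → FiniteInterval A x y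
  covers⇒finite {x} {y} ws c =
    map (clamp x y) ws , λ { (z , p) → clamp-∈ x y z p ws (c z p) }

  finite⇒covers : ∀ {x y} → FiniteInterval A x y → ∃ (Covers x y)
  finite⇒covers {x} {y} (zs , e) =
    map proj₁ zs , λ z p →
      ∈-map⁺ (interval A x y) Eq.setoid {f = proj₁} (λ q → q) {v = z , p} (e (z , p))

  finite-≈ : ∀ {x y} → x ≈ y → FiniteInterval A x y
  finite-≈ {x} e = covers⇒finite (x ∷ []) λ
    { z (inj₁ (p , q)) → here (antisym (trans q (reflexive (Eq.sym e))) p)
    ; z (inj₂ (p , q)) → here (antisym q (trans (reflexive e) p)) }

  finite-⊆ : ∀ {x y x′ y′} → (∀ z → Between A x y z → Between A x′ y′ z) →
             FiniteInterval A x′ y′ → FiniteInterval A x y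
  finite-⊆ h i with finite⇒covers i
  ... | ws , c = covers⇒finite ws λ z p → c z (h z p)

  finite-trans : ∀ {x y z} → FiniteInterval A x y → FiniteInterval A y z →
                 FiniteInterval A x z
  finite-trans {x} {y} {z} i j with finite⇒covers i | finite⇒covers j
  ... | us , c | vs , d = covers⇒finite (us ++ vs) cover
    where
    left : ∀ {w} → Between A x y w → w ∈ us ++ vs
    left {w} p = ∈-++⁺ˡ Eq.setoid (c w p)

    right : ∀ {w} → Between A y z w → w ∈ us ++ vs
    right {w} p = ∈-++⁺ʳ Eq.setoid us (d w p)

    cover : ∀ w → Between A x z w → w ∈ us ++ vs
    cover w (inj₁ (x≤w , w≤z)) with total w y
    ... | inj₁ w≤y = left (inj₁ (x≤w , w≤y))
    ... | inj₂ y≤w = right (inj₁ (y≤w , w≤z))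
    cover w (inj₂ (z≤w , w≤x)) with total w y
    ... | inj₁ w≤y = right (inj₂ (z≤w , w≤y))
    ... | inj₂ y≤w = left (inj₂ (y≤w , w≤x))

  finite-isEquivalence : IsEquivalence (FiniteInterval A)
  finite-isEquivalence = record
    { refl  = finite-≈ Eq.refl
    ; sym   = finite-⊆ λ { z (inj₁ p) → inj₂ p ; z (inj₂ p) → inj₁ p }
    ; trans = finite-trans
    }

  finite-convex : ∀ {x y z} → x ≤ y → y ≤ z → FiniteInterval A x z →
                  FiniteInterval A x y
  finite-convex x≤y y≤z = finite-⊆ λ
    { w (inj₁ (p , q)) → inj₁ (p , trans q y≤z)
    ; w (inj₂ (p , q)) → inj₁ (trans x≤y p , trans q (trans x≤y y≤z)) }

-- The ordinals up to ω, which suffice to speak of rank ω; ω is the only limit.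

Ordinal≤ω : Set
Ordinal≤ω = ℕ ⁺

pattern ω = ⊤⁺

module _ (A : Chain a) where

  ρ-finite : ℕ → ConvexEquivalence A
  ρ-finite zero = record
    { _~_           = TotalOrder._≈_ A
    ; isEquivalence = TotalOrder.isEquivalence A
    ; ≈⇒~           = λ e → e
    ; convex        = λ x≤y y≤z x≈z → antisym x≤y (trans y≤z (reflexive (Eq.sym x≈z)))
    }
    where open TotalOrder A
  ρ-finite (suc n) = record
    { _~_           = FiniteInterval A/n
    ; isEquivalence = finite-isEquivalence
    ; ≈⇒~           = λ e → finite-≈ (ConvexEquivalence.≈⇒~ (ρ-finite n) e)
    ; convex        = λ x≤y y≤z → finite-convex (inj₁ x≤y) (inj₁ y≤z)
    }
    where
    A/n = quotient A (ρ-finite n)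
    open FiniteIntervalProperties A/n

  private
    ρ-mono : ∀ m {n x y} → ConvexEquivalence._~_ (ρ-finite n) x y →
             ConvexEquivalence._~_ (ρ-finite (m + n)) x y
    ρ-mono zero        p = p
    ρ-mono (suc m) {n} p =
      FiniteIntervalProperties.finite-≈ (quotient A (ρ-finite (m + n))) (ρ-mono m {n} p)

  ρ : Ordinal≤ω → ConvexEquivalence A
  ρ [ n ] = ρ-finite n
  ρ ω     = record
    { _~_           = λ x y → ∃[ n ] ConvexEquivalence._~_ (ρ-finite n) x y
    ; isEquivalence = record
      { refl  = 0 , Eq.refl
      ; sym   = λ (n , p) → n , IsEquivalence.sym (isEquivalence (ρ-finite n)) p
      ; trans = λ {x} {y} {z} (m , p) (n , q) →
          n + m , IsEquivalence.trans (isEquivalence (ρ-finite (n + m)))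
            (ρ-mono n {m} p)
            (subst (λ k → _~_ (ρ-finite k) y z) (ℕ.+-comm m n) (ρ-mono m {n} q))
      }
    ; ≈⇒~           = 0 ,_
    ; convex        = λ x≤y y≤z (n , p) → n , convex (ρ-finite n) x≤y y≤z p
    }
    where
    open TotalOrder A using (module Eq)
    open ConvexEquivalence

_/_ : Chain a → Ordinal≤ω → Chain a
A / α = quotient A (ρ A α)

HasRank : Chain a → Ordinal≤ω → Set _
HasRank A α = A / α ≅ 𝟙 × (∀ β → β <⁺ α → ¬ (A / β ≅ 𝟙))

-- s ▹ k extends a sequence of length m by the entry s(m) = k; the bound
-- s(m) ≤ m is k : Fin (suc m).

infixl 5 _▹_

data 𝒮 : ℕ → Set where
  ⟨⟩  : 𝒮 0
  _▹_ : ∀ {m} → 𝒮 m → Fin (suc m) → 𝒮 (suc m)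

last : ∀ {m} → 𝒮 (suc m) → Fin (suc m)
last (_ ▹ k) = k

infix 8 _⁻

_⁻ : ∀ {m} → 𝒮 (suc m) → 𝒮 m
(s ▹ _) ⁻ = s

-- For s of length n + 1 with n = suc m, the argument n ≢ s(n) amounts to
-- s(n) < n and lets s(n) be the last entry of a sequence of length n.

s⁺ : ∀ {m} (s : 𝒮 (suc (suc m))) → suc m ≢ toℕ (last s) → 𝒮 (suc m)
s⁺ s p = s ⁻ ⁻ ▹ lower₁ (last s) p

record Node : Set where
  constructor _⨾_
  field
    {m}    : ℕ
    seq    : 𝒮 (suc m)
    weight : ℕ

-- Finite trees with labelled nodes, indexed by their number of leaves.

data Tree : ℕ → Set where
  leaf   : Node → Tree 1
  unary  : ∀ {l} → Node → Tree l → Tree l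
  binary : ∀ {l r} → Node → Tree l → Tree r → Tree (l + r)

leaves : ∀ {l} → Tree l → Vec Node l
leaves (leaf x)       = x ∷ []
leaves (unary _ t)    = leaves t
leaves (binary _ t u) = leaves t ++ᵛ leaves u

ℓ : ∀ {n} → 𝒮 (suc n) → ℕ
ℓ {zero}  s = 1
ℓ {suc n} s with suc n ≟ toℕ (last s)
... | yes _ = ℓ (s ⁻)
... | no p  = ℓ (s⁺ s p) + ℓ (s ⁻)

-- The subtree rooted at the node (s; k).

tree : ∀ {n} (s : 𝒮 (suc n)) (k : ℕ) → Tree (ℓ s)
tree {zero}  s k = leaf (s ⨾ k)
tree {suc n} s k with suc n ≟ toℕ (last s)
... | yes _ = unary (s ⨾ k) (tree (s ⁻) 0)
... | no p  = binary (s ⨾ k) (tree (s⁺ s p) (suc k)) (tree (s ⁻) 0)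

wt : ∀ {n} (s : 𝒮 (suc n)) → Fin (ℓ s) → ℕ
wt s i = Node.weight (lookup (leaves (tree s 0)) i)

𝒜 : ∀ {n} (s : 𝒮 (suc n)) → (Fin (ℓ s) → Chain a) → Chain a
𝒜 {n = zero}  s M = M zero
𝒜 {n = suc n} s M with suc n ≟ toℕ (last s)
... | yes _ = 𝒜 (s ⁻) M ⊗ ℤ-chain
... | no p  = 𝒜 (s⁺ s p) (λ i → M (i ↑ˡ ℓ (s ⁻)))
            ⊕ 𝒜 (s ⁻) (λ i → M (ℓ (s⁺ s p) ↑ʳ i)) ⊗ ℕ-chain

module Submission where

-- Write x ∼ₖ y for "x and y lie in the same ρ_(ω+k)-class". Everything rests on
-- embeddings whose image is convex: they preserve and reflect every ρ_α, because
-- the intervals that define ρ_α are the same in the domain and in the codomain.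
-- The inclusions of tails, of summands and of the copies of a factor, and all
-- isomorphisms, are such embeddings.
--
-- A uniform chain M of rank ω, wherever it is so embedded, is a full ρ_ω-class
-- apart from a possible continuation to the left: its points are ∼₀-related since
-- its rank is at most ω, and none is ∼₀-related to a point y above the image.
-- Indeed x ρ_n y would put a whole tail of M into one ρ_n-class; by uniformity M
-- would be one ρ_n-class, and its rank finite. The same is then true of the tails
-- of M. In the same sense 𝒜 s M with |s| = n + 1 is a full ρ_(ω+n)-class
-- (`𝒜-block`), by induction on n: adjacent copies of blocks of level n - 1 merge in
-- ρ_(ω+n), but a point of 𝒜 s M is separated from every point above 𝒜 s M by
-- infinitely many copies of 𝒜(s⁻), no two of which share a ρ_(ω+n-1)-class. Two
-- full ρ_ω-classes in one chain, each reaching as far down as the other, are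
-- isomorphic (`coinitial-≅`).
--
-- (a) A tail of A = 𝒜 s M that starts in M_i has a tail of M_i as its least
-- ρ_ω-class, and all tails of A are isomorphic (`tail-≅`).
--
-- (b) Let k be the weight of M_i. Unless M_i is the least ρ_ω-class of A, some
-- copy of M_i is, for a suitable x below it, the least ρ_ω-class above x that is
-- not ∼ₖ-related to x (`𝒜-positions`): where M_i starts a block 𝒜(t) repeated
-- along ℕ or ℤ, with |t| = k + 1, take x in one copy of that block and M_i in the
-- next. An isomorphism of the tails at x and at x′ sends x to x′ and preserves ∼ₖ,
-- so it matches the copies of M_i and M_j obtained in this way when the weights
-- agree (`interior-≅`). If M_i is the least class of A, then its weight is n, which
-- no other class has, since A is a single ρ_(ω+n)-class.

open import Defs
open import Data.Empty using (⊥-elim)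
open import Data.Fin using (Fin; zero; toℕ; _↑ˡ_; _↑ʳ_; join; splitAt)
import Data.Fin.Properties as Fin
import Data.Integer as ℤ
import Data.Integer.Properties as ℤ
open import Data.List as List using ([]; _∷_; map; length)
open import Data.List.Membership.Setoid.Properties using (∈-map⁺; ∈-resp-≈)
open import Data.List.Relation.Unary.Any as Any using (Any; here; there)
open import Data.List.Relation.Unary.Any.Properties using (lookup-index)
open import Data.Nat as ℕ using (ℕ; zero; suc; _≟_)
import Data.Nat.Properties as ℕ
open import Data.Product using (∃; ∃₂; _×_; _,_; proj₁; proj₂)
import Data.Sum as Sum
open import Data.Sum using (_⊎_; inj₁; inj₂)
open import Data.Sum.Relation.Binary.LeftOrder using (₁∼₁; ₁∼₂; ₂∼₂)
open import Data.Sum.Relation.Binary.Pointwise using (inj₁; inj₂)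
open import Data.Unit using (tt)
open import Data.Vec using (lookup)
open import Data.Vec.Properties using (lookup-++ˡ; lookup-++ʳ)
open import Function using (_∘_)
open import Level using (Level; 0ℓ) renaming (suc to lsuc)
open import Relation.Binary using (IsEquivalence; TotalOrder; DecTotalOrder)
open import Relation.Binary.Construct.Add.Supremum.Strict ℕ._<_ using ([_]<⊤⁺)
open import Relation.Binary.Construct.Closure.Equivalence as EqClosure
  using (EqClosure; gfold)
open import Relation.Binary.Morphism.Structures using (IsOrderIsomorphism)
open import Relation.Binary.PropositionalEquality
  using (_≡_; refl; sym; trans; cong; subst; subst₂)
open import Relation.Nullary using (¬_; yes; no)
open import Relation.Nullary.Construct.Add.Supremum using ([_])

private
  variable
    a : Level

-- The relations ρ_(ω+k)

infix 4 _⊢_≤_ _⊢_≈_ _⊢_∼[_]_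

_⊢_≤_ _⊢_≈_ : (A : Chain a) → ∣ A ∣ → ∣ A ∣ → Set a
A ⊢ x ≤ y = TotalOrder._≤_ A x y
A ⊢ x ≈ y = TotalOrder._≈_ A x y

-- The relation ρ_(ω+k): since ρ_(ω+k) on A is ρ_k on A/ω, it is encoded as the
-- latter.

ρω+ : (A : Chain a) (k : ℕ) → ConvexEquivalence (A / ω)
ρω+ A k = ρ-finite (A / ω) k

_⊢_∼[_]_ : (A : Chain a) → ∣ A ∣ → ℕ → ∣ A ∣ → Set a
A ⊢ x ∼[ k ] y = ConvexEquivalence._~_ (ρω+ A k) x y

module _ (A : Chain a) (k : ℕ) where
  private
    module E = ConvexEquivalence (ρω+ A k)

  ∼-isEquivalence : IsEquivalence (λ x y → A ⊢ x ∼[ k ] y)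
  ∼-isEquivalence = E.isEquivalence

  open IsEquivalence ∼-isEquivalence public
    using () renaming (refl to ∼-refl; sym to ∼-sym; trans to ∼-trans)

  ≈⇒∼ : ∀ {x y} → A ⊢ x ≈ y → A ⊢ x ∼[ k ] y
  ≈⇒∼ = E.≈⇒~ ∘ ConvexEquivalence.≈⇒~ (ρ A ω)

  ∼-lower : ∀ {x y z} → A ⊢ x ≤ y → A ⊢ y ≤ z → A ⊢ x ∼[ k ] z → A ⊢ x ∼[ k ] y
  ∼-lower p q = E.convex (inj₁ p) (inj₁ q)

  ∼-upper : ∀ {x y z} → A ⊢ x ≤ y → A ⊢ y ≤ z → A ⊢ x ∼[ k ] z → A ⊢ y ∼[ k ] z
  ∼-upper p q r = ∼-trans (∼-sym (∼-lower p q r)) r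

∼-suc : (A : Chain a) (k : ℕ) → ∀ {x y} → A ⊢ x ∼[ k ] y → A ⊢ x ∼[ suc k ] y
∼-suc A k = FiniteIntervalProperties.finite-≈ (quotient (A / ω) (ρω+ A k))

-- Convex embeddings

-- An order embedding with convex image. Convexity is required in the stronger
-- form that a point above some point of the image is in the image or
-- above all of it, a case distinction that is not available constructively for
-- an arbitrary convex subset.

infix 4 _↪_

record _↪_ (C A : Chain a) : Set a where
  field
    to      : ∣ C ∣ → ∣ A ∣
    mono    : ∀ {x y} → C ⊢ x ≤ y → A ⊢ to x ≤ to y
    cancel  : ∀ {x y} → A ⊢ to x ≤ to y → C ⊢ x ≤ y
    located : ∀ {x z} → A ⊢ to x ≤ z → (∃ λ y → A ⊢ to y ≈ z) ⊎ (∀ y → A ⊢ to y ≤ z)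

open _↪_ using () renaming (to to infixl 9 _⟨$⟩_)

module Embedding {C A : Chain a} (e : C ↪ A) where
  open _↪_ e public
  private
    module A = TotalOrder A
    module C = TotalOrder C

  ≈-mono : ∀ {x y} → C ⊢ x ≈ y → A ⊢ to x ≈ to y
  ≈-mono p = A.antisym (mono (C.reflexive p)) (mono (C.reflexive (C.Eq.sym p)))

  ≈-cancel : ∀ {x y} → A ⊢ to x ≈ to y → C ⊢ x ≈ y
  ≈-cancel p = C.antisym (cancel (A.reflexive p)) (cancel (A.reflexive (A.Eq.sym p)))

  convex : ∀ {x y z} → A ⊢ to x ≤ z → A ⊢ z ≤ to y → ∃ λ w → A ⊢ to w ≈ z
  convex {y = y} p q with located p
  ... | inj₁ r     = r
  ... | inj₂ above = y , A.antisym (above y) q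

  between-mono : ∀ {x y z} → Between C x y z → Between A (to x) (to y) (to z)
  between-mono (inj₁ (p , q)) = inj₁ (mono p , mono q)
  between-mono (inj₂ (p , q)) = inj₂ (mono p , mono q)

  between-cancel : ∀ {x y z w} → A ⊢ to w ≈ z → Between A (to x) (to y) z → Between C x y w
  between-cancel r (inj₁ (p , q)) =
    inj₁ (cancel (A.trans p (A.reflexive (A.Eq.sym r))) , cancel (A.trans (A.reflexive r) q))
  between-cancel r (inj₂ (p , q)) =
    inj₂ (cancel (A.trans p (A.reflexive (A.Eq.sym r))) , cancel (A.trans (A.reflexive r) q))

  between-image : ∀ {x y z} → Between A (to x) (to y) z → ∃ λ w → A ⊢ to w ≈ z
  between-image (inj₁ (p , q)) = convex p q
  between-image (inj₂ (p , q)) = convex p q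

  finite-mono : ∀ {x y} → FiniteInterval C x y → FiniteInterval A (to x) (to y)
  finite-mono {x} {y} i with FiniteIntervalProperties.finite⇒covers C i
  ... | ws , covers = FiniteIntervalProperties.covers⇒finite A (map to ws) λ z p →
    let w , r = between-image p in
    ∈-resp-≈ A.Eq.setoid r
      (∈-map⁺ C.Eq.setoid A.Eq.setoid ≈-mono (covers w (between-cancel r p)))

  finite-cancel : ∀ {x y} → FiniteInterval A (to x) (to y) → FiniteInterval C x y
  finite-cancel {x} {y} (zs , enum) =
    FiniteIntervalProperties.covers⇒finite C (map back zs) λ w p →
      ∈-resp-≈ C.Eq.setoid
        (≈-cancel (proj₂ (between-image (between-mono p))))
        (∈-map⁺ (interval A (to x) (to y)) C.Eq.setoid
          (λ {z} {z′} → back-cong {z} {z′}) {v = to w , between-mono p}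
          (enum (to w , between-mono p)))
    where
    back : ∃ (Between A (to x) (to y)) → ∣ C ∣
    back (z , p) = proj₁ (between-image p)

    back-cong : ∀ {z z′} → A ⊢ proj₁ z ≈ proj₁ z′ → C ⊢ back z ≈ back z′
    back-cong {_ , p} {_ , q} r = ≈-cancel
      (A.Eq.trans (proj₂ (between-image p))
        (A.Eq.trans r (A.Eq.sym (proj₂ (between-image q)))))

quotient-↪ : {C A : Chain a} (e : C ↪ A) (E : ConvexEquivalence C) (F : ConvexEquivalence A) →
  let module E = ConvexEquivalence E; module F = ConvexEquivalence F in
  (∀ {x y} → x E.~ y → (e ⟨$⟩ x) F.~ (e ⟨$⟩ y)) →
  (∀ {x y} → (e ⟨$⟩ x) F.~ (e ⟨$⟩ y) → x E.~ y) →
  quotient C E ↪ quotient A F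
quotient-↪ {C = C} {A} e E F preserves reflects = record
  { to      = to
  ; mono    = λ { (inj₁ p) → inj₁ (mono p) ; (inj₂ p) → inj₂ (preserves p) }
  ; cancel  = λ { (inj₁ p) → inj₁ (cancel p) ; (inj₂ p) → inj₂ (reflects p) }
  ; located = λ { (inj₁ p) → located′ (located p) ; {x = x} (inj₂ p) → inj₁ (x , p) }
  }
  where
  open Embedding e
  module F = ConvexEquivalence F
  located′ : ∀ {z} → (∃ λ y → A ⊢ to y ≈ z) ⊎ (∀ y → A ⊢ to y ≤ z) →
    (∃ λ y → to y F.~ z) ⊎ (∀ y → A ⊢ to y ≤ z ⊎ to y F.~ z)
  located′ (inj₁ (y , p)) = inj₁ (y , F.≈⇒~ p)
  located′ (inj₂ above)   = inj₂ (inj₁ ∘ above)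

module _ {C A : Chain a} (e : C ↪ A) where
  private
    _~C[_]_ : ∣ C ∣ → ℕ → ∣ C ∣ → Set _
    x ~C[ n ] y = ConvexEquivalence._~_ (ρ-finite C n) x y

    _~A[_]_ : ∣ A ∣ → ℕ → ∣ A ∣ → Set _
    x ~A[ n ] y = ConvexEquivalence._~_ (ρ-finite A n) x y

  ρ-mono   : ∀ n {x y} → x ~C[ n ] y → (e ⟨$⟩ x) ~A[ n ] (e ⟨$⟩ y)
  ρ-cancel : ∀ n {x y} → (e ⟨$⟩ x) ~A[ n ] (e ⟨$⟩ y) → x ~C[ n ] y

  ρ-mono zero    = Embedding.≈-mono e
  ρ-mono (suc n) = Embedding.finite-mono
    (quotient-↪ e (ρ-finite C n) (ρ-finite A n) (ρ-mono n) (ρ-cancel n))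

  ρ-cancel zero    = Embedding.≈-cancel e
  ρ-cancel (suc n) = Embedding.finite-cancel
    (quotient-↪ e (ρ-finite C n) (ρ-finite A n) (ρ-mono n) (ρ-cancel n))

/ω-↪ : {C A : Chain a} → C ↪ A → C / ω ↪ A / ω
/ω-↪ {C = C} {A} e = quotient-↪ e (ρ C ω) (ρ A ω)
  (λ (n , p) → n , ρ-mono e n p) (λ (n , p) → n , ρ-cancel e n p)

module _ {C A : Chain a} (e : C ↪ A) (k : ℕ) where
  ∼-mono : ∀ {x y} → C ⊢ x ∼[ k ] y → A ⊢ e ⟨$⟩ x ∼[ k ] e ⟨$⟩ y
  ∼-mono = ρ-mono (/ω-↪ e) k

  ∼-cancel : ∀ {x y} → A ⊢ e ⟨$⟩ x ∼[ k ] e ⟨$⟩ y → C ⊢ x ∼[ k ] y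
  ∼-cancel = ρ-cancel (/ω-↪ e) k

infixr 9 _∘↪_

_∘↪_ : {C A B : Chain a} → A ↪ B → C ↪ A → C ↪ B
_∘↪_ {B = B} g e = record
  { to      = G.to ∘ E.to
  ; mono    = G.mono ∘ E.mono
  ; cancel  = E.cancel ∘ G.cancel
  ; located = loc
  }
  where
  module G = Embedding g
  module E = Embedding e
  module B = TotalOrder B
  loc : ∀ {x z} → B ⊢ G.to (E.to x) ≤ z →
        (∃ λ y → B ⊢ G.to (E.to y) ≈ z) ⊎ (∀ y → B ⊢ G.to (E.to y) ≤ z)
  loc p with G.located p
  ... | inj₂ above = inj₂ (above ∘ E.to)
  ... | inj₁ (u , q) with E.located (G.cancel (B.trans p (B.reflexive (B.Eq.sym q))))
  ...   | inj₁ (y , r) = inj₁ (y , B.Eq.trans (G.≈-mono r) q)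
  ...   | inj₂ above   = inj₂ λ y → B.trans (G.mono (above y)) (B.reflexive q)

id-↪ : (A : Chain a) → A ↪ A
id-↪ A = record
  { to      = λ x → x
  ; mono    = λ p → p
  ; cancel  = λ p → p
  ; located = λ {_} {z} _ → inj₁ (z , TotalOrder.Eq.refl A)
  }

tail-↪ : (A : Chain a) (x : ∣ A ∣) → A ^≥ x ↪ A
tail-↪ A x = record
  { to      = proj₁
  ; mono    = λ p → p
  ; cancel  = λ p → p
  ; located = λ { {_ , p} {z} q → inj₁ ((z , TotalOrder.trans A p q) , TotalOrder.Eq.refl A) }
  }

restrict-↪ : {C A : Chain a} (e : C ↪ A) {x : ∣ A ∣} → (∀ c → A ⊢ x ≤ e ⟨$⟩ c) → C ↪ A ^≥ x
restrict-↪ e above = record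
  { to      = λ c → e ⟨$⟩ c , above c
  ; mono    = _↪_.mono e
  ; cancel  = _↪_.cancel e
  ; located = _↪_.located e
  }

≅⇒↪ : {A B : Chain a} → A ≅ B → A ↪ B
≅⇒↪ {A = A} (h , iso) = record
  { to      = h
  ; mono    = I.mono
  ; cancel  = I.cancel
  ; located = λ {_} {z} _ → inj₁ (proj₁ (I.surjective z) , proj₂ (I.surjective z) (TotalOrder.Eq.refl A))
  }
  where module I = IsOrderIsomorphism iso

module _ (A B : Chain a) where
  inˡ-↪ : A ↪ A ⊕ B
  inˡ-↪ = record
    { to      = inj₁
    ; mono    = ₁∼₁
    ; cancel  = λ { (₁∼₁ p) → p }
    ; located = λ { {z = inj₁ z} _ → inj₁ (z , inj₁ (TotalOrder.Eq.refl A))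
                  ; {z = inj₂ z} _ → inj₂ λ _ → ₁∼₂ }
    }

  inʳ-↪ : B ↪ A ⊕ B
  inʳ-↪ = record
    { to      = inj₂
    ; mono    = ₂∼₂
    ; cancel  = λ { (₂∼₂ p) → p }
    ; located = λ { {z = inj₂ z} (₂∼₂ _) → inj₁ (z , inj₂ (TotalOrder.Eq.refl B)) }
    }

module _ (A : Chain a) (J : DecTotalOrder 0ℓ 0ℓ 0ℓ) where
  private
    module J = DecTotalOrder J

  copy-↪ : J.Carrier → A ↪ A ⊗ J
  copy-↪ j = record
    { to      = j ,_
    ; mono    = λ p → inj₂ (J.Eq.refl , p)
    ; cancel  = λ { (inj₁ (_ , j≉j)) → ⊥-elim (j≉j J.Eq.refl) ; (inj₂ (_ , p)) → p }
    ; located = λ { (inj₁ j<k)            → inj₂ λ _ → inj₁ j<k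
                  ; {z = _ , z} (inj₂ (j≈k , _)) → inj₁ (z , j≈k , TotalOrder.Eq.refl A) }
    }

-- Blocks

-- A block of level k is a nonempty chain that is a full ρ_(ω+k)-class of every
-- chain in which it is embedded, except that the class may extend further to the
-- left.

record Block (k : ℕ) (C : Chain a) : Set (lsuc a) where
  field
    point : ∣ C ∣
    whole : ∀ x y → C ⊢ x ∼[ k ] y
    ends  : {A : Chain a} (e : C ↪ A) {x : ∣ C ∣} {y : ∣ A ∣} →
            (∀ z → A ⊢ e ⟨$⟩ z ≤ y) → ¬ A ⊢ e ⟨$⟩ x ∼[ k ] y

-- It is enough that C is a single ρ_ω-class and that no ρ_n-class with n finite
-- contains a tail of C.

block-zero : (C : Chain a) → ∣ C ∣ → (∀ x y → C ⊢ x ∼[ 0 ] y) →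
  (∀ n x → ¬ (∀ y → C ⊢ x ≤ y → ConvexEquivalence._~_ (ρ-finite C n) x y)) → Block 0 C
block-zero C point whole unbounded = record
  { point = point
  ; whole = whole
  ; ends  = λ {A} e {x} above (n , p) → unbounded n x λ z x≤z →
      ρ-cancel e n (ConvexEquivalence.convex (ρ-finite A n) (_↪_.mono e x≤z) (above z) p)
  }

module _ {M : Chain a} (u : Uniform M) (r : HasRank M ω) where
  open Uniform u
  private
    module M = TotalOrder M
    module ~ n = ConvexEquivalence (ρ-finite M n)
    module ~≡ n = IsEquivalence (ConvexEquivalence.isEquivalence (ρ-finite M n))

    -- By uniformity every tail lies in one ρ_n-class as soon as one does.

    unbounded : ∀ n x → ¬ (∀ y → M ⊢ x ≤ y → ~._~_ n x y)
    unbounded n x bounded = proj₂ r [ n ] [ n ]<⊤⁺ ((λ _ → tt) , record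
      { isOrderMonomorphism = record
        { isOrderHomomorphism = record { cong = λ _ → refl ; mono = λ _ → refl }
        ; injective           = λ {y} {z} _ → all y z
        ; cancel              = λ {y} {z} _ → inj₂ (all y z)
        }
      ; surjective = λ _ → point , λ _ → refl
      })
      where
      from : ∀ y z → M ⊢ y ≤ z → ~._~_ n y z
      from y z y≤z = ~≡.trans n (~≡.sym n (start y M.refl)) (start z y≤z)
        where
        h : M ^≥ x ↪ M ^≥ y
        h = ≅⇒↪ (tails x y)

        start : ∀ w → M ⊢ y ≤ w → ~._~_ n (proj₁ (h ⟨$⟩ (x , M.refl))) w
        start w y≤w with proj₂ (tails x y) .IsOrderIsomorphism.surjective (w , y≤w)
        ... | (v , x≤v) , hv = ~≡.trans n
          (ρ-mono (tail-↪ M y) n (ρ-mono h n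
            (ρ-cancel (tail-↪ M x) n {x , M.refl} {v , x≤v} (bounded v x≤v))))
          (~.≈⇒~ n (hv {v , x≤v} M.Eq.refl))

      all : ∀ y z → ~._~_ n y z
      all y z with M.total y z
      ... | inj₁ p = from y z p
      ... | inj₂ p = ~≡.sym n (from z y p)

    whole : ∀ x y → M ⊢ x ∼[ 0 ] y
    whole x y = IsOrderIsomorphism.injective (proj₂ (proj₁ r)) refl

  uniform-block : Block 0 M
  uniform-block = block-zero M point whole unbounded

  tail-block : ∀ x → Block 0 (M ^≥ x)
  tail-block x = block-zero (M ^≥ x) (x , M.refl)
    (λ y z → ∼-cancel (tail-↪ M x) 0 (whole (proj₁ y) (proj₁ z)))
    λ n y bounded → unbounded n (proj₁ y) λ z y≤z →
      ρ-mono (tail-↪ M x) n (bounded (z , M.trans (proj₂ y) y≤z) y≤z)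

-- Sums and products of blocks

-- Adjacent blocks of level k merge in ρ_(ω+k+1).

merge : {A C D : Chain a} {k : ℕ} → Block k C → Block k D → (e : C ↪ A) (g : D ↪ A) → ∀ {x y} →
  A ⊢ e ⟨$⟩ x ≤ g ⟨$⟩ y →
  (∀ z → A ⊢ e ⟨$⟩ x ≤ z → A ⊢ z ≤ g ⟨$⟩ y →
    (∃ λ w → A ⊢ e ⟨$⟩ w ≈ z) ⊎ (∃ λ w → A ⊢ g ⟨$⟩ w ≈ z)) →
  A ⊢ e ⟨$⟩ x ∼[ suc k ] g ⟨$⟩ y
merge {A = A} {k = k} b c e g {x} {y} x≤y split =
  F.covers⇒finite (e ⟨$⟩ x ∷ g ⟨$⟩ y ∷ []) λ
    { z (inj₁ (p , q)) → cover z (≲⇒≤⊎∼ p) (≲⇒≤⊎∼ q)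
    ; z (inj₂ (p , q)) → here (A/.antisym q (A/.trans (inj₁ (inj₁ x≤y)) p)) }
  where
  module A/ = TotalOrder (quotient (A / ω) (ρω+ A k))
  module F = FiniteIntervalProperties (quotient (A / ω) (ρω+ A k))

  ≲⇒≤⊎∼ : ∀ {z w} → quotient (A / ω) (ρω+ A k) ⊢ z ≤ w → A ⊢ z ≤ w ⊎ A ⊢ z ∼[ k ] w
  ≲⇒≤⊎∼ (inj₁ (inj₁ p)) = inj₁ p
  ≲⇒≤⊎∼ (inj₁ (inj₂ p)) = inj₂ (ConvexEquivalence.≈⇒~ (ρω+ A k) p)
  ≲⇒≤⊎∼ (inj₂ p)        = inj₂ p

  cover : ∀ z → A ⊢ e ⟨$⟩ x ≤ z ⊎ A ⊢ e ⟨$⟩ x ∼[ k ] z →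
    A ⊢ z ≤ g ⟨$⟩ y ⊎ A ⊢ z ∼[ k ] g ⟨$⟩ y →
    Any (λ w → A ⊢ z ∼[ k ] w) (e ⟨$⟩ x ∷ g ⟨$⟩ y ∷ [])
  cover z (inj₂ p) _        = here (∼-sym A k p)
  cover z (inj₁ _) (inj₂ q) = there (here q)
  cover z (inj₁ p) (inj₁ q) with split z p q
  ... | inj₁ (w , r) = here
    (∼-trans A k (∼-sym A k (≈⇒∼ A k r)) (∼-mono e k (Block.whole b w x)))
  ... | inj₂ (w , r) = there (here
    (∼-trans A k (∼-sym A k (≈⇒∼ A k r)) (∼-mono g k (Block.whole c w y))))

-- If infinitely many copies of a block of level k fit between x and y, then a
-- finite cover of the interval by ∼ₖ-classes would put points of two of them
-- into the same class.

ascent : {A D : Chain a} {k : ℕ} (b : Block k D) (g : ℕ → D ↪ A) →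
  (∀ {i j} → i ℕ.< j → ∀ z w → A ⊢ g i ⟨$⟩ z ≤ g j ⟨$⟩ w) → ∀ {x y} →
  (∀ i z → A ⊢ x ≤ g i ⟨$⟩ z) → (∀ i z → A ⊢ g i ⟨$⟩ z ≤ y) → ¬ A ⊢ x ∼[ suc k ] y
ascent {A = A} {k = k} b g increasing {x} {y} above below x∼y
  with FiniteIntervalProperties.finite⇒covers (quotient (A / ω) (ρω+ A k)) x∼y
... | ws , covers = contra (Fin.pigeonhole (ℕ.n<1+n (length ws)) (Any.index ∘ found))
  where
  p : ℕ → ∣ A ∣
  p i = g i ⟨$⟩ Block.point b

  found : ∀ (i : Fin (suc (length ws))) → Any (λ w → A ⊢ p (toℕ i) ∼[ k ] w) ws
  found i = covers (p (toℕ i)) (inj₁ (inj₁ (inj₁ (above _ _)) , inj₁ (inj₁ (below _ _))))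

  contra : ¬ ∃₂ λ i j → (toℕ i ℕ.< toℕ j) × (Any.index (found i) ≡ Any.index (found j))
  contra (i , j , i<j , eq) = Block.ends b (g (toℕ i)) (λ z → increasing i<j z (Block.point b))
    (∼-trans A k (lookup-index (found i))
      (subst (λ l → A ⊢ List.lookup ws l ∼[ k ] p (toℕ j)) (sym eq)
        (∼-sym A k (lookup-index (found j)))))

-- An order with a point in which every element has an immediate successor and
-- any two elements are finitely many successor steps apart.

record Discrete (J : DecTotalOrder 0ℓ 0ℓ 0ℓ) : Set where
  open DecTotalOrder J using (Carrier; _≤_; _≈_)
  field
    origin : Carrier
    next   : Carrier → Carrier
    next-> : ∀ j → j ≤ next j × ¬ j ≈ next j
    gap    : ∀ i j → i ≤ j ⊎ next j ≤ i
    linked : ∀ i j → EqClosure (λ i j → j ≡ next i) i j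

ℕ-discrete : Discrete ℕ-chain
ℕ-discrete = record
  { origin = 0
  ; next   = suc
  ; next-> = λ j → ℕ.n≤1+n j , ℕ.1+n≢n ∘ sym
  ; gap    = gap
  ; linked = λ i j → EqClosure.transitive _ (EqClosure.symmetric _ (from-0 i)) (from-0 j)
  }
  where
  gap : ∀ i j → i ℕ.≤ j ⊎ suc j ℕ.≤ i
  gap i j with i ℕ.≤? j
  ... | yes p = inj₁ p
  ... | no  p = inj₂ (ℕ.≰⇒> p)

  from-0 : ∀ i → EqClosure (λ i j → j ≡ suc i) 0 i
  from-0 zero    = EqClosure.reflexive _
  from-0 (suc i) = EqClosure.transitive _ (from-0 i) (EqClosure.return refl)

ℤ-discrete : Discrete ℤ-chain
ℤ-discrete = record
  { origin = ℤ.+ 0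
  ; next   = ℤ.suc
  ; next-> = λ j → ℤ.<⇒≤ (j<1+j j) , ℤ.<⇒≢ (j<1+j j)
  ; gap    = gap
  ; linked = λ i j → EqClosure.transitive _ (EqClosure.symmetric _ (from-0 i)) (from-0 j)
  }
  where
  j<1+j : ∀ j → j ℤ.< ℤ.suc j
  j<1+j j = ℤ.suc[i]≤j⇒i<j ℤ.≤-refl

  gap : ∀ i j → i ℤ.≤ j ⊎ ℤ.suc j ℤ.≤ i
  gap i j with i ℤ.≤? j
  ... | yes p = inj₁ p
  ... | no  p = inj₂ (ℤ.i<j⇒suc[i]≤j (ℤ.≰⇒> p))

  from-0 : ∀ i → EqClosure (λ i j → j ≡ ℤ.suc i) (ℤ.+ 0) i
  from-0 (ℤ.+ zero)     = EqClosure.reflexive _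
  from-0 (ℤ.+ suc n)    = EqClosure.transitive _ (from-0 (ℤ.+ n)) (EqClosure.return refl)
  from-0 ℤ.-[1+ zero ]  = EqClosure.symmetric _ (EqClosure.return refl)
  from-0 ℤ.-[1+ suc n ] =
    EqClosure.transitive _ (from-0 ℤ.-[1+ n ]) (EqClosure.symmetric _ (EqClosure.return refl))

module _ {J : DecTotalOrder 0ℓ 0ℓ 0ℓ} (d : Discrete J) {C : Chain a} {k : ℕ} (b : Block k C) where
  open Discrete d
  private
    module J = DecTotalOrder J
    copy = copy-↪ C J

    first-≤ : ∀ {i j c c′} → C ⊗ J ⊢ (i , c) ≤ (j , c′) → i J.≤ j
    first-≤ (inj₁ (p , _)) = p
    first-≤ (inj₂ (p , _)) = J.reflexive p

    step : ∀ j → C ⊗ J ⊢ (j , Block.point b) ∼[ suc k ] (next j , Block.point b)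
    step j = merge b b (copy j) (copy (next j)) (inj₁ (next-> j)) λ (i , c) p q → Sum.map
      (λ i≤j → c , J.antisym (first-≤ p) i≤j , TotalOrder.Eq.refl C)
      (λ j<i → c , J.antisym j<i (first-≤ q) , TotalOrder.Eq.refl C)
      (gap i j)

    iterate : ℕ → J.Carrier → J.Carrier
    iterate zero    j = j
    iterate (suc n) j = next (iterate n j)

    iterate-< : ∀ {m n} j → m ℕ.< n →
      iterate m j J.≤ iterate n j × ¬ iterate m j J.≈ iterate n j
    iterate-< {m} {suc n} j m<1+n with ℕ.m≤n⇒m<n∨m≡n (ℕ.s≤s⁻¹ m<1+n)
    ... | inj₂ refl = next-> (iterate n j)
    ... | inj₁ m<n  = let p , q = iterate-< j m<n ; r , _ = next-> (iterate n j) in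
      J.trans p r ,
      λ eq → q (J.antisym p (J.trans r (J.reflexive (J.Eq.sym eq))))

    within : ∀ j x y → C ⊗ J ⊢ (j , x) ∼[ suc k ] (j , y)
    within j x y = ∼-suc (C ⊗ J) k (∼-mono (copy j) k (Block.whole b x y))

    across : ∀ i j → C ⊗ J ⊢ (i , Block.point b) ∼[ suc k ] (j , Block.point b)
    across i j = gfold (∼-isEquivalence (C ⊗ J) (suc k)) (_, Block.point b)
      (λ { refl → step _ }) (linked i j)

  ⊗-block : Block (suc k) (C ⊗ J)
  ⊗-block = record
    { point = origin , Block.point b
    ; whole = λ (i , x) (j , y) →
        ∼-trans (C ⊗ J) (suc k) (within i x (Block.point b))
          (∼-trans (C ⊗ J) (suc k) (across i j) (within j (Block.point b) y))
    ; ends  = λ { e {j , x} above →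
        ascent b (λ n → e ∘↪ copy (iterate (suc n) j))
          (λ m<n z w → _↪_.mono e (inj₁ (iterate-< j (ℕ.s≤s m<n))))
          (λ n z → _↪_.mono e (inj₁ (iterate-< {0} {suc n} j (ℕ.s≤s ℕ.z≤n))))
          (λ n z → above _) }
    }

module _ {C D : Chain a} {k : ℕ} (b : Block k C) (c : Block k D) where
  private
    E : Chain a
    E = C ⊕ D ⊗ ℕ-chain

    module C = Block b
    module E = Block (⊗-block ℕ-discrete c)

    inˡ : C ↪ E
    inˡ = inˡ-↪ C (D ⊗ ℕ-chain)

    inʳ : D ⊗ ℕ-chain ↪ E
    inʳ = inʳ-↪ C (D ⊗ ℕ-chain)

    junction : E ⊢ inj₁ C.point ∼[ suc k ] inj₂ E.point
    junction = merge b c inˡ (inʳ ∘↪ copy-↪ D ℕ-chain 0) ₁∼₂ split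
      where
      split : ∀ z → E ⊢ inj₁ C.point ≤ z → E ⊢ z ≤ inj₂ E.point →
        (∃ λ w → E ⊢ inj₁ w ≈ z) ⊎ (∃ λ w → E ⊢ inj₂ (0 , w) ≈ z)
      split (inj₁ w)       _ _                       = inj₁ (w , inj₁ (TotalOrder.Eq.refl C))
      split (inj₂ (i , w)) _ (₂∼₂ (inj₁ (i≤0 , i≢0))) = ⊥-elim (i≢0 (ℕ.n≤0⇒n≡0 i≤0))
      split (inj₂ (i , w)) _ (₂∼₂ (inj₂ (refl , _))) =
        inj₂ (w , inj₂ (refl , TotalOrder.Eq.refl D))

    to-junction : ∀ z → E ⊢ z ∼[ suc k ] inj₂ E.point
    to-junction (inj₁ x) = ∼-trans E (suc k)
      (∼-suc E k (∼-mono inˡ k (C.whole x C.point))) junction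
    to-junction (inj₂ y) = ∼-mono inʳ (suc k) (E.whole y E.point)

  ⊕-block : Block (suc k) (C ⊕ D ⊗ ℕ-chain)
  ⊕-block = record
    { point = inj₂ E.point
    ; whole = λ x y → ∼-trans E (suc k) (to-junction x) (∼-sym E (suc k) (to-junction y))
    ; ends  = λ {A} e {x} {y} above x∼y → E.ends (e ∘↪ inʳ) (above ∘ inj₂)
        (∼-trans A (suc k) (∼-mono e (suc k) (∼-sym E (suc k) (to-junction x))) x∼y)
    }

𝒜-block : ∀ {n} (s : 𝒮 (suc n)) (M : Fin (ℓ s) → Chain a) →
  (∀ i → Block 0 (M i)) → Block n (𝒜 s M)
𝒜-block {n = zero}  s M b = b zero
𝒜-block {n = suc n} s M b with suc n ≟ toℕ (last s)
... | yes _ = ⊗-block ℤ-discrete (𝒜-block (s ⁻) M b)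
... | no p  = ⊕-block (𝒜-block (s⁺ s p) _ (b ∘ (_↑ˡ ℓ (s ⁻))))
                      (𝒜-block (s ⁻) _ (b ∘ (ℓ (s⁺ s p) ↑ʳ_)))

-- Least classes above a point

-- Two full ρ_ω-classes in one chain coincide if each reaches below every point of
-- the other.

coinitial-≅ : {A C D : Chain a} → Block 0 C → Block 0 D → (e : C ↪ A) (g : D ↪ A) →
  (∀ c → ∃ λ d → A ⊢ g ⟨$⟩ d ≤ e ⟨$⟩ c) → (∀ d → ∃ λ c → A ⊢ e ⟨$⟩ c ≤ g ⟨$⟩ d) → C ≅ D
coinitial-≅ {A = A} {C} {D} b b′ e g below below′ = proj₁ ∘ into b b′ e g below below′ , record
  { isOrderMonomorphism = record
    { isOrderHomomorphism = record
      { cong = λ {x} {y} p → G.≈-cancel (A.Eq.trans (eq x) (A.Eq.trans (E.≈-mono p) (A.Eq.sym (eq y))))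
      ; mono = λ {x} {y} p → G.cancel (A.trans (A.reflexive (eq x))
          (A.trans (E.mono p) (A.reflexive (A.Eq.sym (eq y)))))
      }
    ; injective = λ {x} {y} p → E.≈-cancel
        (A.Eq.trans (A.Eq.sym (eq x)) (A.Eq.trans (G.≈-mono p) (eq y)))
    ; cancel = λ {x} {y} p → E.cancel (A.trans (A.reflexive (A.Eq.sym (eq x)))
        (A.trans (G.mono p) (A.reflexive (eq y))))
    }
  ; surjective = λ d → let c , p = into b′ b g e below′ below d in c , λ {c′} q →
      G.≈-cancel (A.Eq.trans (eq c′) (A.Eq.trans (E.≈-mono q) p))
  }
  where
  module A = TotalOrder A
  module E = Embedding e
  module G = Embedding g

  into : {C D : Chain _} → Block 0 C → Block 0 D → (e : C ↪ A) (g : D ↪ A) →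
    (∀ c → ∃ λ d → A ⊢ g ⟨$⟩ d ≤ e ⟨$⟩ c) → (∀ d → ∃ λ c → A ⊢ e ⟨$⟩ c ≤ g ⟨$⟩ d) →
    ∀ c → ∃ λ d → A ⊢ g ⟨$⟩ d ≈ e ⟨$⟩ c
  into b b′ e g below below′ c with below c
  ... | d , p with _↪_.located g p
  ...   | inj₁ found = found
  ...   | inj₂ above with below′ d
  ...     | c′ , q = ⊥-elim (Block.ends b′ g above (∼-upper A 0 q p (∼-mono e 0 (Block.whole b c′ c))))

  eq : ∀ c → A ⊢ g ⟨$⟩ proj₁ (into b b′ e g below below′ c) ≈ e ⟨$⟩ c
  eq c = proj₂ (into b b′ e g below below′ c)

-- An embedded copy of C in A that comes first, in the tail of A at base, among the
-- points not ∼ₖ-related to base.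

record Interior (k : ℕ) (C A : Chain a) : Set a where
  field
    base  : ∣ A ∣
    copy  : C ↪ A
    above : ∀ c → A ⊢ base ≤ copy ⟨$⟩ c
    apart : ∀ c → ¬ A ⊢ base ∼[ k ] copy ⟨$⟩ c
    least : ∀ z → A ⊢ base ≤ z → A ⊢ base ∼[ k ] z ⊎ (∃ λ c → A ⊢ copy ⟨$⟩ c ≤ z)

-- C is embedded in A coinitially, hence onto an initial segment.

Initial : (C A : Chain a) → Set a
Initial C A = ∃ λ (e : C ↪ A) → ∀ z → ∃ λ c → A ⊢ e ⟨$⟩ c ≤ z

-- The position in A of the chain C at a leaf of weight k, where d is the weight
-- that belongs to the initial position.

Position : (d k : ℕ) (C A : Chain a) → Set a
Position d k C A = (k ≡ d × Initial C A) ⊎ Interior k C A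

interior-↪ : {A B C : Chain a} {k : ℕ} → ∣ C ∣ → A ↪ B → Interior k C A → Interior k C B
interior-↪ {B = B} {k = k} c g i = record
  { base  = g ⟨$⟩ I.base
  ; copy  = g ∘↪ I.copy
  ; above = λ c → G.mono (I.above c)
  ; apart = λ c → I.apart c ∘ ∼-cancel g k
  ; least = least
  }
  where
  module B = TotalOrder B
  module G = Embedding g
  module I = Interior i
  least : ∀ z → B ⊢ g ⟨$⟩ I.base ≤ z →
    B ⊢ g ⟨$⟩ I.base ∼[ k ] z ⊎ (∃ λ c → B ⊢ g ⟨$⟩ (I.copy ⟨$⟩ c) ≤ z)
  least z p with G.located p
  ... | inj₂ beyond = inj₂ (c , beyond _)
  ... | inj₁ (y , q) with I.least y (G.cancel (B.trans p (B.reflexive (B.Eq.sym q))))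
  ...   | inj₁ r       = inj₁ (∼-trans B k (∼-mono g k r) (≈⇒∼ B k q))
  ...   | inj₂ (c , r) = inj₂ (c , B.trans (G.mono r) (B.reflexive q))

-- The initial leaf of a factor is interior in the product, with the base
-- in the preceding copy.

⊗-position : {J : DecTotalOrder 0ℓ 0ℓ 0ℓ} → Discrete J → {C A : Chain a} {n k : ℕ} → ∣ C ∣ →
  Block n A → Position n k C A → Interior k C (A ⊗ J)
⊗-position {J = J} d {A = A} c b (inj₂ i) = interior-↪ c (copy-↪ A J (Discrete.origin d)) i
⊗-position {J = J} d {A = A} {n} c b (inj₁ (refl , e , initial)) = record
  { base  = origin , Block.point b
  ; copy  = copy-↪ A J (next origin) ∘↪ e
  ; above = λ _ → inj₁ (next-> origin)
  ; apart = λ _ → Block.ends b (copy-↪ A J origin) λ _ → inj₁ (next-> origin)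
  ; least = least
  }
  where
  open Discrete d
  module J = DecTotalOrder J
  module A = TotalOrder A

  beyond : ∀ i → next origin J.≤ i → ∀ x → A ⊗ J ⊢ (next origin , x) ≤ (i , x)
  beyond i p x with next origin J.≟ i
  ... | yes q = inj₂ (q , A.refl)
  ... | no  q = inj₁ (p , q)

  least : ∀ z → A ⊗ J ⊢ (origin , Block.point b) ≤ z →
    A ⊗ J ⊢ (origin , Block.point b) ∼[ n ] z ⊎
    (∃ λ c → A ⊗ J ⊢ (next origin , e ⟨$⟩ c) ≤ z)
  least (i , x) (inj₂ (p , _)) = inj₁ (∼-trans (A ⊗ J) n
    (∼-mono (copy-↪ A J origin) n (Block.whole b (Block.point b) x))
    (≈⇒∼ (A ⊗ J) n (p , A.Eq.refl)))
  least (i , x) (inj₁ (p , q)) with gap i origin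
  ... | inj₁ r = ⊥-elim (q (J.antisym p r))
  ... | inj₂ r = inj₂ (proj₁ (initial x) , TotalOrder.trans (A ⊗ J)
    (_↪_.mono (copy-↪ A J (next origin)) (proj₂ (initial x))) (beyond i r x))

⊕-positionˡ : {C A B : Chain a} {d k : ℕ} → ∣ C ∣ → Position d k C A → Position d k C (A ⊕ B)
⊕-positionˡ {A = A} {B} c (inj₂ i) = inj₂ (interior-↪ c (inˡ-↪ A B) i)
⊕-positionˡ {A = A} {B} c (inj₁ (eq , e , initial)) = inj₁ (eq , inˡ-↪ A B ∘↪ e , λ where
  (inj₁ x) → proj₁ (initial x) , ₁∼₁ (proj₂ (initial x))
  (inj₂ _) → c , ₁∼₂)

weight : ∀ {l} → Tree l → Fin l → ℕ
weight t i = Node.weight (lookup (leaves t) i)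

-- A leaf of (s;w) is initial in 𝒜 s M only if it is reached by n left steps, and
-- then has weight w + n.

𝒜-positions : ∀ {n} (s : 𝒮 (suc n)) (w : ℕ) (M : Fin (ℓ s) → Chain a) →
  (∀ i → Block 0 (M i)) → ∀ i → Position (w ℕ.+ n) (weight (tree s w) i) (M i) (𝒜 s M)
𝒜-positions {n = zero} s w M b zero =
  inj₁ (sym (ℕ.+-identityʳ w) , id-↪ (M zero) , λ z → z , TotalOrder.refl (M zero))
𝒜-positions {n = suc n} s w M b with suc n ≟ toℕ (last s)
... | yes _ = λ i → inj₂ (⊗-position ℤ-discrete (Block.point (b i)) (𝒜-block (s ⁻) M b)
                            (𝒜-positions (s ⁻) 0 M b i))
... | no p  = λ i → subst P (Fin.join-splitAt l r i) (cases (splitAt l i))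
  where
  l = ℓ (s⁺ s p)
  r = ℓ (s ⁻)

  Mˡ : Fin l → Chain _
  Mˡ i = M (i ↑ˡ r)

  Mʳ : Fin r → Chain _
  Mʳ i = M (l ↑ʳ i)

  A B : Chain _
  A = 𝒜 (s⁺ s p) Mˡ
  B = 𝒜 (s ⁻) Mʳ

  P : Fin (l ℕ.+ r) → Set _
  P i = Position (w ℕ.+ suc n)
    (weight (binary (s ⨾ w) (tree (s⁺ s p) (suc w)) (tree (s ⁻) 0)) i) (M i) (A ⊕ B ⊗ ℕ-chain)

  cases : ∀ i → P (join l r i)
  cases (inj₁ i) = subst₂ (λ d k → Position d k (Mˡ i) (A ⊕ B ⊗ ℕ-chain))
    (sym (ℕ.+-suc w n))
    (sym (cong Node.weight (lookup-++ˡ (leaves (tree (s⁺ s p) (suc w))) (leaves (tree (s ⁻) 0)) i)))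
    (⊕-positionˡ (Block.point (b (i ↑ˡ r)))
      (𝒜-positions (s⁺ s p) (suc w) Mˡ (b ∘ (_↑ˡ r)) i))
  cases (inj₂ i) = subst (λ k → Position (w ℕ.+ suc n) k (Mʳ i) (A ⊕ B ⊗ ℕ-chain))
    (sym (cong Node.weight (lookup-++ʳ (leaves (tree (s⁺ s p) (suc w))) (leaves (tree (s ⁻) 0)) i)))
    (inj₂ (interior-↪ (Block.point (b (l ↑ʳ i))) (inʳ-↪ A (B ⊗ ℕ-chain))
      (⊗-position ℕ-discrete (Block.point (b (l ↑ʳ i))) (𝒜-block (s ⁻) Mʳ (b ∘ (l ↑ʳ_)))
        (𝒜-positions (s ⁻) 0 Mʳ (b ∘ (l ↑ʳ_)) i))))

-- Comparison of tails

module TailIsomorphism {A : Chain a} {x y : ∣ A ∣} (h : A ^≥ x ≅ A ^≥ y) where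
  private
    module A = TotalOrder A

  h↪ : A ^≥ x ↪ A ^≥ y
  h↪ = ≅⇒↪ h

  preimage : ∀ z → ∃ λ w → A ^≥ y ⊢ h↪ ⟨$⟩ w ≈ z
  preimage z = let w , p = IsOrderIsomorphism.surjective (proj₂ h) z in w , p {w} A.Eq.refl

  least : ∀ {x≤x} z → A ^≥ y ⊢ h↪ ⟨$⟩ (x , x≤x) ≤ z
  least {x≤x} z = let (w , x≤w) , p = preimage z in
    A.trans (_↪_.mono h↪ {x , x≤x} {w , x≤w} x≤w) (A.reflexive p)

  least≈ : A ^≥ y ⊢ h↪ ⟨$⟩ (x , A.refl) ≈ (y , A.refl)
  least≈ = A.antisym (least (y , A.refl)) (proj₂ (h↪ ⟨$⟩ (x , A.refl)))

  -- An isomorphism of tails preserves and reflects being ∼ₖ-related to the least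
  -- point.

  ∼-transfer : ∀ k w → A ⊢ x ∼[ k ] proj₁ w → A ⊢ y ∼[ k ] proj₁ (h↪ ⟨$⟩ w)
  ∼-transfer k w p = ∼-trans A k (∼-sym A k (≈⇒∼ A k least≈))
    (∼-mono (tail-↪ A y ∘↪ h↪) k {x , A.refl} {w} (∼-cancel (tail-↪ A x) k {x , A.refl} {w} p))

  ∼-transfer⁻ : ∀ k w → A ⊢ y ∼[ k ] proj₁ (h↪ ⟨$⟩ w) → A ⊢ x ∼[ k ] proj₁ w
  ∼-transfer⁻ k w p = ∼-mono (tail-↪ A x) k {x , A.refl} {w}
    (∼-cancel (tail-↪ A y ∘↪ h↪) k {x , A.refl} {w} (∼-trans A k (≈⇒∼ A k least≈) p))

tail-≅ : {A M N : Chain a} → Uniform A → (u : Uniform M) (v : Uniform N) →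
  HasRank M ω → HasRank N ω → M ↪ A → N ↪ A → f u ≅ f v
tail-≅ {A = A} {M} {N} w u v r r′ e g = coinitial-≅
  (tail-block u r (point u)) (tail-block v r′ (point v))
  (h↪ ∘↪ restrict-↪ (e ∘↪ tail-↪ M (point u)) (λ c → _↪_.mono e (proj₂ c)))
  (restrict-↪ (g ∘↪ tail-↪ N (point v)) (λ d → _↪_.mono g (proj₂ d)))
  (λ c → (point v , TotalOrder.refl N) , proj₂ (h↪ ⟨$⟩ _))
  (λ d → (point u , TotalOrder.refl M) ,
    least ((g ⟨$⟩ proj₁ d) , _↪_.mono g (proj₂ d)))
  where
  open Uniform using (point)
  open TailIsomorphism {A = A} (Uniform.tails w (e ⟨$⟩ point u) (g ⟨$⟩ point v))

interior-≅ : {A C D : Chain a} {k : ℕ} → Uniform A → Block 0 C → Block 0 D →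
  Interior k C A → Interior k D A → C ≅ D
interior-≅ {A = A} {C} {D} {k} u b b′ i j = coinitial-≅ b b′
  (h↪ ∘↪ restrict-↪ I.copy I.above) (restrict-↪ J.copy J.above) below below′
  where
  module A = TotalOrder A
  module I = Interior i
  module J = Interior j
  open TailIsomorphism {A = A} (Uniform.tails u I.base J.base)

  below : ∀ c → ∃ λ d → A ⊢ J.copy ⟨$⟩ d ≤ proj₁ (h↪ ⟨$⟩ (I.copy ⟨$⟩ c , I.above c))
  below c with J.least _ (proj₂ (h↪ ⟨$⟩ (I.copy ⟨$⟩ c , I.above c)))
  ... | inj₁ p     = ⊥-elim (I.apart c (∼-transfer⁻ k (I.copy ⟨$⟩ c , I.above c) p))
  ... | inj₂ found = found

  below′ : ∀ d → ∃ λ c → A ⊢ proj₁ (h↪ ⟨$⟩ (I.copy ⟨$⟩ c , I.above c)) ≤ J.copy ⟨$⟩ d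
  below′ d with preimage (J.copy ⟨$⟩ d , J.above d)
  ... | (z , x≤z) , p with I.least z x≤z
  ...   | inj₁ q = ⊥-elim (J.apart d
    (∼-trans A k (∼-transfer k (z , x≤z) q) (≈⇒∼ A k p)))
  ...   | inj₂ (c , q) = c , A.trans
    (_↪_.mono h↪ {I.copy ⟨$⟩ c , I.above c} {z , x≤z} q) (A.reflexive p)

mainTheorem2 : ∀ {a : Level} (n : ℕ) (s : 𝒮 (suc n)) (M : Fin (ℓ s) → Chain a)
    (M-uniform : ∀ i → Uniform (M i)) (M-rank : ∀ i → HasRank (M i) ω) →
    Uniform (𝒜 s M) →
    (∀ i j → f (M-uniform i) ≅ f (M-uniform j)) × (∀ i j → wt s i ≡ wt s j → M i ≅ M j)
mainTheorem2 n s M M-uniform M-rank A-uniform =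
  (λ i j → tail-≅ A-uniform (M-uniform i) (M-uniform j) (M-rank i) (M-rank j)
    (embed i) (embed j)) ,
  λ i j eq → compare i j eq (position i) (position j)
  where
  A = 𝒜 s M

  b : ∀ i → Block 0 (M i)
  b i = uniform-block (M-uniform i) (M-rank i)

  position : ∀ i → Position n (wt s i) (M i) A
  position = 𝒜-positions s 0 M b

  embed : ∀ i → M i ↪ A
  embed i with position i
  ... | inj₁ (_ , e , _) = e
  ... | inj₂ p           = Interior.copy p

  -- All of A is ∼ₙ-related, so that no interior leaf has weight n.
  weight≢n : ∀ {C} → ∣ C ∣ → ¬ Interior n C A
  weight≢n c p = Interior.apart p c (Block.whole (𝒜-block s M b) _ _)

  compare : ∀ i j → wt s i ≡ wt s j →
    Position n (wt s i) (M i) A → Position n (wt s j) (M j) A → M i ≅ M j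
  compare i j eq (inj₁ (_ , e , initial)) (inj₁ (_ , g , initial′)) =
    coinitial-≅ (b i) (b j) e g (λ c → initial′ (e ⟨$⟩ c)) (λ d → initial (g ⟨$⟩ d))
  compare i j eq (inj₁ (p , _)) (inj₂ q) = ⊥-elim
    (weight≢n (Block.point (b j)) (subst (λ k → Interior k (M j) A) (trans (sym eq) p) q))
  compare i j eq (inj₂ p) (inj₁ (q , _)) = ⊥-elim
    (weight≢n (Block.point (b i)) (subst (λ k → Interior k (M i) A) (trans eq q) p))
  compare i j eq (inj₂ p) (inj₂ q) = interior-≅ A-uniform (b i) (b j)
    (subst (λ k → Interior k (M i) A) eq p) q
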